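{- Let $L$ be one of the logics $\mathbf{K4}_h$, $\mathbf{KD4}_h$, $\mathbf{S4}_h$, and let $G(L)$ be the corresponding sequent calculus $G(\mathbf{K4}_h)$, $G(\mathbf{KD4}_h)$, $G(\mathbf{S4}_h)$ described in the context. Then $G(L)$ is equivalent to $L$: for all finite multisets $\Gamma,\Delta$ of formulas of $\mathcal{L}_\infty$, the sequent $\Gamma\Rightarrow\Delta$ is provable in $G(L)$ if and only if $L\vdash \bigwedge\Gamma\rightarrow\bigvee\Delta$ (empty conjunction $=\top$, empty disjunction $=\bot$); in particular $L\vdash A$ iff $G(L)\vdash\ \Rightarrow A$.
   Context: The language $\mathcal{L}_\infty$ consists of modal formulas built from propositional atoms, $\bot,\top$, the connectives $\neg,\wedge,\vee,\rightarrow$ and infinitely many unary modalities $\Box_n$ ($n\in\mathbb{N}$), with the restriction that $\Box_n A$ is a formula only if $n$ is strictly greater than the index of every box occurring in $A$. All formulas below are assumed to be in $\mathcal{L}_\infty$ (so axiom instances and rule applications are only those producing $\mathcal{L}_\infty$-formulas). Hilbert systems: consider the axiom schemes (for all $n\ge 0$) $\mathbf{H}$: $\Box_n A\rightarrow\Box_{n+1}A$; $\mathbf{K}_h$: $\Box_n(A\rightarrow B)\rightarrow(\Box_nA\rightarrow\Box_nB)$; $\mathbf{4}_h$: $\Box_nA\rightarrow\Box_{n+1}\Box_nA$; $\mathbf{D}_h$: $\neg\Box_n\bot$; $\mathbf{T}_h$: $\Box_nA\rightarrow A$. For a set $X$ of schemes, $L(X)$ is the least set of $\mathcal{L}_\infty$-formulas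 containing all classical propositional tautologies (over $\mathcal{L}_\infty$-formulas) and all instances of the schemes in $X$, and closed under modus ponens and the rule: from $A$ infer $\Box_nA$ for any $n$ greater than all box indices in $A$. $\mathbf{K4}_h=L(\mathbf{H},\mathbf{K}_h,\mathbf{4}_h)$, $\mathbf{KD4}_h=L(\mathbf{H},\mathbf{K}_h,\mathbf{4}_h,\mathbf{D}_h)$, $\mathbf{S4}_h=L(\mathbf{H},\mathbf{K}_h,\mathbf{4}_h,\mathbf{T}_h)$. Sequent calculi: sequents $\Gamma\Rightarrow\Delta$ with finite multisets. All three systems contain the axioms $A\Rightarrow A$ and $\bot\Rightarrow$, the structural rules of left/right weakening, left/right contraction and cut (from $\Gamma_0\Rightarrow\Delta_0,A$ and $\Gamma_1,A\Rightarrow\Delta_1$ infer $\Gamma_0,\Gamma_1\Rightarrow\Delta_0,\Delta_1$), and the usual classical (LK-style) left and right rules for $\wedge,\vee,\rightarrow,\neg$. Modal rules (in each, the side condition is $n_i<n$ for all $i\in I$): $\Box_{4_h}R$: from $\{\sigma_r\}_{r\in R},\{\gamma_i,\Box_{n_i}\gamma_i\}_{i\in I}\Rightarrow A$ infer $\{\Box_n\sigma_r\}_{r\in R},\{\Box_{n_i}\gamma_i\}_{i\in I}\Rightarrow\Box_nA$; $\Box_{D_h}R$: from $\{\sigma_r\}_{r\in R},\{\gamma_i,\Box_{n_i}\gamma_i\}_{i\in I}\Rightarrow$ infer $\{\Box_n\sigma_r\}_{r\in R},\{\Box_{n_i}\gamma_i\}_{i\in I}\Rightarrow$; $\Box_{S_h}R$: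 from $\{\sigma_r\}_{r\in R},\{\Box_{n_i}\gamma_i\}_{i\in I}\Rightarrow A$ infer $\{\Box_n\sigma_r\}_{r\in R},\{\Box_{n_i}\gamma_i\}_{i\in I}\Rightarrow\Box_nA$; $\Box_hL$: from $\Gamma,A\Rightarrow\Delta$ infer $\Gamma,\Box_nA\Rightarrow\Delta$. $G(\mathbf{K4}_h)$ = axioms + structural + propositional rules + $\Box_{4_h}R$; $G(\mathbf{KD4}_h)$ = $G(\mathbf{K4}_h)$ + $\Box_{D_h}R$; $G(\mathbf{S4}_h)$ = axioms + structural + propositional rules + $\Box_{S_h}R$ + $\Box_hL$.
   Formalization: The sequent calculi additionally contain the axiom ⇒ ⊤: with ⊤ a primitive constant and only the axioms A ⇒ A and ⊥ ⇒, the sequent ⇒ ⊤ would be unprovable although ⊤ is a tautology of L. -}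

module Defs where

open import Data.Bool as Bool using (Bool; true; false; not)
open import Data.List using (List; []; _∷_; [_]; _++_; map; foldr)
open import Data.List.Membership.Propositional using (_∈_)
open import Data.List.Relation.Binary.Permutation.Propositional using (_↭_)
open import Data.List.Relation.Unary.All using (All)
open import Data.Nat using (ℕ; suc; _<_)
open import Data.Product using (∃; _×_; _,_; proj₁; proj₂)
open import Relation.Binary.PropositionalEquality using (_≡_)

infix  9 ¬_
infixr 8 _∧_
infixr 7 _∨_
infixr 6 _⟶_
infix  5 _≺_
infix  4 _⇒_

-- The language 𝓛∞.  A box can only be formed together with a proof that its
-- index exceeds every box index in its body.  That proof is irrelevant, so a
-- boxed formula is determined by its index and body.

data Fm : Set
indices : Fm → List ℕ
_≺_ : Fm → ℕ → Set

data Fm where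
  atom : ℕ → Fm
  ⊥ ⊤  : Fm
  ¬_   : Fm → Fm
  _∧_ _∨_ _⟶_ : Fm → Fm → Fm
  □    : (n : ℕ) (A : Fm) → .(A ≺ n) → Fm

indices (atom p)  = []
indices ⊥         = []
indices ⊤         = []
indices (¬ A)     = indices A
indices (A ∧ B)   = indices A ++ indices B
indices (A ∨ B)   = indices A ++ indices B
indices (A ⟶ B)   = indices A ++ indices B
indices (□ n A _) = n ∷ indices A

A ≺ n = All (_< n) (indices A)

⋀ ⋁ : List Fm → Fm
⋀ = foldr _∧_ ⊤
⋁ = foldr _∨_ ⊥

-- Propositional evaluation treats atoms and boxed formulas as the
-- propositionally prime ones; only the values of v at those are consulted.

⟦_⟧ : Fm → (Fm → Bool) → Bool
⟦ atom p ⟧    v = v (atom p)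
⟦ ⊥ ⟧         v = false
⟦ ⊤ ⟧         v = true
⟦ ¬ A ⟧       v = not (⟦ A ⟧ v)
⟦ A ∧ B ⟧     v = ⟦ A ⟧ v Bool.∧ ⟦ B ⟧ v
⟦ A ∨ B ⟧     v = ⟦ A ⟧ v Bool.∨ ⟦ B ⟧ v
⟦ A ⟶ B ⟧     v = not (⟦ A ⟧ v) Bool.∨ ⟦ B ⟧ v
⟦ □ n A A≺n ⟧ v = v (□ n A A≺n)

Tautology : Fm → Set
Tautology A = ∀ v → ⟦ A ⟧ v ≡ true

-- Hilbert systems

data Scheme : Set where
  H Kₕ 4ₕ Dₕ Tₕ : Scheme

data Instance : Scheme → Fm → Set where
  H  : ∀ {n A} .(p : A ≺ n) .(q : A ≺ suc n) →
       Instance H (□ n A p ⟶ □ (suc n) A q)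
  Kₕ : ∀ {n A B} .(p : (A ⟶ B) ≺ n) .(q : A ≺ n) .(r : B ≺ n) →
       Instance Kₕ (□ n (A ⟶ B) p ⟶ (□ n A q ⟶ □ n B r))
  4ₕ : ∀ {n A} .(p : A ≺ n) .(q : □ n A p ≺ suc n) →
       Instance 4ₕ (□ n A p ⟶ □ (suc n) (□ n A p) q)
  Dₕ : ∀ {n} .(p : ⊥ ≺ n) →
       Instance Dₕ (¬ □ n ⊥ p)
  Tₕ : ∀ {n A} .(p : A ≺ n) →
       Instance Tₕ (□ n A p ⟶ A)

data HilbertSystem (X : List Scheme) : Fm → Set where
  tautology     : ∀ {A} → Tautology A → HilbertSystem X A
  axiom         : ∀ {s A} → s ∈ X → Instance s A → HilbertSystem X A
  modusPonens   : ∀ {A B} → HilbertSystem X (A ⟶ B) → HilbertSystem X A →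
                  HilbertSystem X B
  necessitation : ∀ {n A} .(p : A ≺ n) → HilbertSystem X A →
                  HilbertSystem X (□ n A p)

-- Sequents.  Finite multisets are represented by lists; the calculus below is
-- closed under permutation of either side.

record Sequent : Set where
  constructor _⇒_
  field
    antecedent succedent : List Fm

-- The formulas that □ₙ may be applied to.

record Below (n : ℕ) : Set where
  constructor _,_
  field
    body   : Fm
    .below : body ≺ n

open Below public using (body)

box : ∀ {n} → Below n → Fm
box {n} (A , A≺n) = □ n A A≺n

-- (n , γ) : BoxData stands for the boxed formula □ₙ γ.

BoxData : Set
BoxData = ∃ Below

bodies boxes : List BoxData → List Fm
bodies = map (λ γ → body (proj₂ γ))
boxes  = map (λ γ → box (proj₂ γ))

data ModalRule : Set where
  □4R □DR □SR □L : ModalRule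

-- ModalInference r S S′: rule r infers S′ from S.

data ModalInference : ModalRule → Sequent → Sequent → Set where
  □4R : ∀ n (σs : List (Below n)) (γs : List BoxData) (A : Below n) →
        All (λ γ → proj₁ γ < n) γs →
        ModalInference □4R
          (map body σs ++ bodies γs ++ boxes γs ⇒ [ body A ])
          (map box σs ++ boxes γs ⇒ [ box A ])
  □DR : ∀ n (σs : List (Below n)) (γs : List BoxData) →
        All (λ γ → proj₁ γ < n) γs →
        ModalInference □DR
          (map body σs ++ bodies γs ++ boxes γs ⇒ [])
          (map box σs ++ boxes γs ⇒ [])
  □SR : ∀ n (σs : List (Below n)) (γs : List BoxData) (A : Below n) →
        All (λ γ → proj₁ γ < n) γs →
        ModalInference □SR
          (map body σs ++ boxes γs ⇒ [ body A ])
          (map box σs ++ boxes γs ⇒ [ box A ])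
  □L  : ∀ {Γ Δ} n (A : Below n) →
        ModalInference □L (body A ∷ Γ ⇒ Δ) (box A ∷ Γ ⇒ Δ)

-- The axiom ⊤R is the rule for the primitive constant ⊤: without it ⇒ ⊤ would
-- be underivable although ⊤ is a tautology.

data SequentCalculus (Y : List ModalRule) : Sequent → Set where
  ax  : ∀ {A} → SequentCalculus Y ([ A ] ⇒ [ A ])
  ⊥L  : SequentCalculus Y ([ ⊥ ] ⇒ [])
  ⊤R  : SequentCalculus Y ([] ⇒ [ ⊤ ])

  exchange     : ∀ {Γ Γ′ Δ Δ′} → Γ ↭ Γ′ → Δ ↭ Δ′ →
                 SequentCalculus Y (Γ ⇒ Δ) → SequentCalculus Y (Γ′ ⇒ Δ′)
  weakeningL   : ∀ {Γ Δ A} → SequentCalculus Y (Γ ⇒ Δ) →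
                 SequentCalculus Y (A ∷ Γ ⇒ Δ)
  weakeningR   : ∀ {Γ Δ A} → SequentCalculus Y (Γ ⇒ Δ) →
                 SequentCalculus Y (Γ ⇒ A ∷ Δ)
  contractionL : ∀ {Γ Δ A} → SequentCalculus Y (A ∷ A ∷ Γ ⇒ Δ) →
                 SequentCalculus Y (A ∷ Γ ⇒ Δ)
  contractionR : ∀ {Γ Δ A} → SequentCalculus Y (Γ ⇒ A ∷ A ∷ Δ) →
                 SequentCalculus Y (Γ ⇒ A ∷ Δ)
  cut          : ∀ {Γ₀ Γ₁ Δ₀ Δ₁ A} →
                 SequentCalculus Y (Γ₀ ⇒ A ∷ Δ₀) →
                 SequentCalculus Y (A ∷ Γ₁ ⇒ Δ₁) →
                 SequentCalculus Y (Γ₀ ++ Γ₁ ⇒ Δ₀ ++ Δ₁)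

  ∧L₁ : ∀ {Γ Δ A B} → SequentCalculus Y (A ∷ Γ ⇒ Δ) →
        SequentCalculus Y (A ∧ B ∷ Γ ⇒ Δ)
  ∧L₂ : ∀ {Γ Δ A B} → SequentCalculus Y (B ∷ Γ ⇒ Δ) →
        SequentCalculus Y (A ∧ B ∷ Γ ⇒ Δ)
  ∧R  : ∀ {Γ Δ A B} → SequentCalculus Y (Γ ⇒ A ∷ Δ) →
        SequentCalculus Y (Γ ⇒ B ∷ Δ) → SequentCalculus Y (Γ ⇒ A ∧ B ∷ Δ)
  ∨L  : ∀ {Γ Δ A B} → SequentCalculus Y (A ∷ Γ ⇒ Δ) →
        SequentCalculus Y (B ∷ Γ ⇒ Δ) → SequentCalculus Y (A ∨ B ∷ Γ ⇒ Δ)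
  ∨R₁ : ∀ {Γ Δ A B} → SequentCalculus Y (Γ ⇒ A ∷ Δ) →
        SequentCalculus Y (Γ ⇒ A ∨ B ∷ Δ)
  ∨R₂ : ∀ {Γ Δ A B} → SequentCalculus Y (Γ ⇒ B ∷ Δ) →
        SequentCalculus Y (Γ ⇒ A ∨ B ∷ Δ)
  ⟶L  : ∀ {Γ₀ Γ₁ Δ₀ Δ₁ A B} → SequentCalculus Y (Γ₀ ⇒ A ∷ Δ₀) →
        SequentCalculus Y (B ∷ Γ₁ ⇒ Δ₁) →
        SequentCalculus Y ((A ⟶ B) ∷ Γ₀ ++ Γ₁ ⇒ Δ₀ ++ Δ₁)
  ⟶R  : ∀ {Γ Δ A B} → SequentCalculus Y (A ∷ Γ ⇒ B ∷ Δ) →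
        SequentCalculus Y (Γ ⇒ (A ⟶ B) ∷ Δ)
  ¬L  : ∀ {Γ Δ A} → SequentCalculus Y (Γ ⇒ A ∷ Δ) →
        SequentCalculus Y (¬ A ∷ Γ ⇒ Δ)
  ¬R  : ∀ {Γ Δ A} → SequentCalculus Y (A ∷ Γ ⇒ Δ) →
        SequentCalculus Y (Γ ⇒ ¬ A ∷ Δ)

  modal : ∀ {r S S′} → r ∈ Y → ModalInference r S S′ →
          SequentCalculus Y S → SequentCalculus Y S′

data Logic : Set where
  K4ₕ KD4ₕ S4ₕ : Logic

schemes : Logic → List Scheme
schemes K4ₕ  = H ∷ Kₕ ∷ 4ₕ ∷ []
schemes KD4ₕ = H ∷ Kₕ ∷ 4ₕ ∷ Dₕ ∷ []
schemes S4ₕ  = H ∷ Kₕ ∷ 4ₕ ∷ Tₕ ∷ []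

modalRules : Logic → List ModalRule
modalRules K4ₕ  = □4R ∷ []
modalRules KD4ₕ = □4R ∷ □DR ∷ []
modalRules S4ₕ  = □SR ∷ □L ∷ []

infix 3 _⊢_ G_⊢_

_⊢_ : Logic → Fm → Set
L ⊢ A = HilbertSystem (schemes L) A

G_⊢_ : Logic → Sequent → Set
G L ⊢ S = SequentCalculus (modalRules L) S

{-# OPTIONS --safe #-}

-- Soundness: read a sequent as a statement about Boolean valuations.  The
-- structural and propositional rules preserve truth, hence are tautological
-- consequences.  For the modal rules, normality turns ⋀Γ → A into Ξ → □ₙA as
-- soon as Ξ → □ₙC for every C in Γ, and H and 4ₕ yield □ₘγ → □ₙγ and
-- □ₘγ → □ₙ□ₘγ whenever m < n.
--
-- Completeness: with cut it suffices to derive the tautologies and the axioms.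
-- For tautologies we use Kalmár's argument: the prime subformulas true under v
-- on the left and those false under v on the right decide every formula as v
-- does, and the prime formulas are then cut away one at a time.

module Submission where

open import Defs
open import Data.Bool as Bool using (Bool; true; false; not; T; if_then_else_)
open import Data.Bool.Properties using (T-≡; T-∧; T-∨)
open import Data.List using (List; []; _∷_; [_]; _++_; map; filter)
open import Data.List.Properties using (++-identityʳ)
open import Data.List.Membership.Propositional using (_∈_)
open import Data.List.Membership.Propositional.Properties
  using (∈-∃++; ∈-++⁺ʳ; ∈-++⁻; ∈-filter⁺; ∈-filter⁻)
open import Data.List.Relation.Binary.Permutation.Propositional
  using (_↭_; ↭-refl; ↭-swap; ↭-reflexive; ↭-sym; prep)
open import Data.List.Relation.Binary.Permutation.Propositional.Properties
  using (All-resp-↭; Any-resp-↭; ++-comm; shift)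
open import Data.List.Relation.Binary.Subset.Propositional using (_⊆_)
open import Data.List.Relation.Binary.Subset.Propositional.Properties
  using (⊆-refl; ∷⁺ʳ; ∈-∷⁺ʳ)
open import Data.List.Relation.Unary.All as All using (All; []; _∷_)
import Data.List.Relation.Unary.All.Properties as All
open import Data.List.Relation.Unary.Any as Any using (Any; here; there)
import Data.List.Relation.Unary.Any.Properties as Any
open import Data.Nat using (ℕ; suc; _<_; _≤_; _≤′_; ≤′-refl; ≤′-step)
import Data.Nat.Properties as ℕ
open import Data.Product using (∃; _×_; _,_; proj₁; proj₂)
open import Data.Sum as Sum using (_⊎_; inj₁; inj₂)
open import Function using (_∘_; id; case_of_)
open import Function.Bundles using (_⇔_; mk⇔; Equivalence)
open import Relation.Binary.Definitions using (DecidableEquality)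
open import Relation.Binary.PropositionalEquality using (_≡_; _≢_; refl; cong; subst)
open import Relation.Nullary using (Dec; yes; no; contradiction)
open import Relation.Nullary.Decidable using (map′; _×-dec_; ⌊_⌋)

open Equivalence using (to; from)

-- Decidable equality of formulas

-- Comparing head constructors first leaves only the diagonal cases to decide.
tag : Fm → ℕ
tag (atom _)  = 0
tag ⊥         = 1
tag ⊤         = 2
tag (¬ _)     = 3
tag (_ ∧ _)   = 4
tag (_ ∨ _)   = 5
tag (_ ⟶ _)   = 6
tag (□ _ _ _) = 7

infix 4 _≟_

_≟_ : DecidableEquality Fm
≟-sameTag : ∀ A B → tag A ≡ tag B → Dec (A ≡ B)

A ≟ B with tag A ℕ.≟ tag B
... | yes eq = ≟-sameTag A B eq
... | no neq = no (neq ∘ cong tag)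

≟-sameTag (atom p) (atom q) refl =
  map′ (λ { refl → refl }) (λ { refl → refl }) (p ℕ.≟ q)
≟-sameTag ⊥ ⊥ refl = yes refl
≟-sameTag ⊤ ⊤ refl = yes refl
≟-sameTag (¬ A) (¬ B) refl =
  map′ (λ { refl → refl }) (λ { refl → refl }) (A ≟ B)
≟-sameTag (A ∧ B) (C ∧ D) refl =
  map′ (λ { (refl , refl) → refl }) (λ { refl → refl , refl }) (A ≟ C ×-dec B ≟ D)
≟-sameTag (A ∨ B) (C ∨ D) refl =
  map′ (λ { (refl , refl) → refl }) (λ { refl → refl , refl }) (A ≟ C ×-dec B ≟ D)
≟-sameTag (A ⟶ B) (C ⟶ D) refl =
  map′ (λ { (refl , refl) → refl }) (λ { refl → refl , refl }) (A ≟ C ×-dec B ≟ D)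
-- The bounds are irrelevant, so equal indices and equal bodies already give equal boxed formulas.
≟-sameTag (□ m A _) (□ n B _) refl =
  map′ (λ { (refl , refl) → refl }) (λ { refl → refl , refl }) (m ℕ.≟ n ×-dec A ≟ B)

-- Truth of formulas and sequents under a valuation

Valuation : Set
Valuation = Fm → Bool

infix 4 _⊨_
infix 3 _⊩_

_⊨_ : Valuation → Fm → Set
v ⊨ A = T (⟦ A ⟧ v)

-- With `All` and `Any` in place of `⋀` and `⋁`, checking a rule becomes pattern matching on which
-- side formula holds.
_⊩_ : Valuation → Sequent → Set
v ⊩ Γ ⇒ Δ = All (v ⊨_) Γ → Any (v ⊨_) Δ

T-implies⁺ : ∀ a {b} → (T a → T b) → T (not a Bool.∨ b)
T-implies⁺ false _ = _
T-implies⁺ true  f = f _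

T-implies⁻ : ∀ a {b} → T (not a Bool.∨ b) → T a → T b
T-implies⁻ true t _ = t

module _ {v : Valuation} where

  ⟶⁺ : ∀ A B → (v ⊨ A → v ⊨ B) → v ⊨ A ⟶ B
  ⟶⁺ A _ = T-implies⁺ (⟦ A ⟧ v)

  ⟶⁻ : ∀ A B → v ⊨ A ⟶ B → v ⊨ A → v ⊨ B
  ⟶⁻ A _ = T-implies⁻ (⟦ A ⟧ v)

  ¬⁻ : ∀ A → v ⊨ ¬ A → v ⊨ A → v ⊨ ⊥
  ¬⁻ A = go (⟦ A ⟧ v)
    where
    go : ∀ a → T (not a) → T a → T false
    go true t _ = t

  -- The classical case split behind the right rules for `⟶` and `¬`.
  ⊨-cases : ∀ A → (v ⊨ A) ⊎ (v ⊨ ¬ A)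
  ⊨-cases A with ⟦ A ⟧ v
  ... | true  = inj₁ _
  ... | false = inj₂ _

  ⋀⁺ : ∀ {Γ} → All (v ⊨_) Γ → v ⊨ ⋀ Γ
  ⋀⁺ []       = _
  ⋀⁺ (a ∷ as) = from T-∧ (a , ⋀⁺ as)

  ⋀⁻ : ∀ Γ → v ⊨ ⋀ Γ → All (v ⊨_) Γ
  ⋀⁻ []      _ = []
  ⋀⁻ (_ ∷ Γ) t = proj₁ (to T-∧ t) ∷ ⋀⁻ Γ (proj₂ (to T-∧ t))

  ⋁⁺ : ∀ {Δ} → Any (v ⊨_) Δ → v ⊨ ⋁ Δ
  ⋁⁺ (here a)   = from T-∨ (inj₁ a)
  ⋁⁺ (there as) = from T-∨ (inj₂ (⋁⁺ as))

  ⋁⁻ : ∀ Δ → v ⊨ ⋁ Δ → Any (v ⊨_) Δ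
  ⋁⁻ (_ ∷ Δ) t with to T-∨ t
  ... | inj₁ a  = here a
  ... | inj₂ as = there (⋁⁻ Δ as)

formula : Sequent → Fm
formula (Γ ⇒ Δ) = ⋀ Γ ⟶ ⋁ Δ

⊨⇒⊩ : ∀ {v} S → v ⊨ formula S → v ⊩ S
⊨⇒⊩ (Γ ⇒ Δ) t = ⋁⁻ Δ ∘ ⟶⁻ (⋀ Γ) (⋁ Δ) t ∘ ⋀⁺

⊩⇒⊨ : ∀ {v} S → v ⊩ S → v ⊨ formula S
⊩⇒⊨ (Γ ⇒ Δ) f = ⟶⁺ (⋀ Γ) (⋁ Δ) (⋁⁺ ∘ f ∘ ⋀⁻ Γ)

-- Hilbert systems

≺-mono : ∀ A {m n} → m ≤ n → A ≺ m → A ≺ n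
≺-mono _ m≤n = All.map (λ i<m → ℕ.<-≤-trans i<m m≤n)

module Hilbert {X : List Scheme} where

  infix 3 ⊢_

  ⊢_ : Fm → Set
  ⊢ A = HilbertSystem X A

  valid : ∀ A → (∀ v → v ⊨ A) → ⊢ A
  valid A t = tautology (λ v → to T-≡ (t v))

  -- The semantic implication makes `A ⟶ B` a tautology. Propositional reasoning in the Hilbert
  -- system is thereby reduced to reasoning about valuations.
  consequence₁ : ∀ {A} B → (∀ v → v ⊨ A → v ⊨ B) → ⊢ A → ⊢ B
  consequence₁ {A} B f = modusPonens (valid (A ⟶ B) (λ v → ⟶⁺ A B (f v)))

  consequence₂ : ∀ {A B} C → (∀ v → v ⊨ A → v ⊨ B → v ⊨ C) → ⊢ A → ⊢ B → ⊢ C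
  consequence₂ {A} {B} C f a =
    modusPonens (consequence₁ (B ⟶ C) (λ v → ⟶⁺ B C ∘ f v) a)

  sequent₀ : ∀ S → (∀ v → v ⊩ S) → ⊢ formula S
  sequent₀ S f = valid (formula S) (λ v → ⊩⇒⊨ S (f v))

  sequent₁ : ∀ S S′ → (∀ v → v ⊩ S → v ⊩ S′) → ⊢ formula S → ⊢ formula S′
  sequent₁ S S′ f = consequence₁ (formula S′) (λ v → ⊩⇒⊨ S′ ∘ f v ∘ ⊨⇒⊩ S)

  sequent₂ : ∀ S S′ S″ → (∀ v → v ⊩ S → v ⊩ S′ → v ⊩ S″) →
             ⊢ formula S → ⊢ formula S′ → ⊢ formula S″
  sequent₂ S S′ S″ f =
    consequence₂ (formula S″) (λ v s s′ → ⊩⇒⊨ S″ (f v (⊨⇒⊩ S s) (⊨⇒⊩ S′ s′)))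

  ⟶-refl : ∀ A → ⊢ A ⟶ A
  ⟶-refl A = valid (A ⟶ A) (λ v → ⟶⁺ A A id)

  ⟶-trans : ∀ {A B C} → ⊢ A ⟶ B → ⊢ B ⟶ C → ⊢ A ⟶ C
  ⟶-trans {A} {B} {C} = consequence₂ (A ⟶ C)
    (λ v f g → ⟶⁺ A C (⟶⁻ B C g ∘ ⟶⁻ A B f))

  ⟶-ap : ∀ {A B C} → ⊢ A ⟶ (B ⟶ C) → ⊢ A ⟶ B → ⊢ A ⟶ C
  ⟶-ap {A} {B} {C} = consequence₂ (A ⟶ C)
    (λ v f g → ⟶⁺ A C (λ a → ⟶⁻ B C (⟶⁻ A (B ⟶ C) f a) (⟶⁻ A B g a)))

  ⋀-project : ∀ {Γ C} → C ∈ Γ → ⊢ ⋀ Γ ⟶ C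
  ⋀-project {Γ} {C} C∈Γ =
    valid (⋀ Γ ⟶ C) (λ v → ⟶⁺ (⋀ Γ) C (λ t → All.lookup (⋀⁻ Γ t) C∈Γ))

  -- The bound travels with the derivation because `□ n C` cannot be written without it;
  -- `All (Boxable Ξ n)` can then range over a whole context.
  record Boxable (Ξ : Fm) (n : ℕ) (C : Fm) : Set where
    constructor boxable
    field
      .bound  : C ≺ n
      derived : ⊢ Ξ ⟶ □ n C bound

  -- Soundness of the modal rules

  module Normal (H∈X : H ∈ X) (Kₕ∈X : Kₕ ∈ X) (4ₕ∈X : 4ₕ ∈ X) where

    -- Iterates `H`; the constructors of `≤′` raise the upper index by one, exactly as `H` does.
    □-mono : ∀ {m n A} .(p : A ≺ m) .(q : A ≺ n) → m ≤′ n → ⊢ □ m A p ⟶ □ n A q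
    □-mono p q ≤′-refl = ⟶-refl _
    □-mono {A = A} p q (≤′-step m≤n) =
      ⟶-trans (□-mono p (≺-mono A (ℕ.≤′⇒≤ m≤n) p) m≤n)
              (axiom H∈X (H (≺-mono A (ℕ.≤′⇒≤ m≤n) p) q))

    □-mono< : ∀ {m n A} .(p : A ≺ m) .(q : A ≺ n) → m < n → ⊢ □ m A p ⟶ □ n A q
    □-mono< p q m<n = □-mono p q (ℕ.≤⇒≤′ (ℕ.<⇒≤ m<n))

    -- `4ₕ` reaches the outer index `suc m`. Since `m < n` unfolds to `suc m ≤ n`, `□-mono` covers
    -- the rest.
    □-transitive : ∀ {m n A} .(p : A ≺ m) .(q : □ m A p ≺ n) → m < n →
                   ⊢ □ m A p ⟶ □ n (□ m A p) q
    □-transitive {A = A} p q m<n =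
      ⟶-trans (axiom 4ₕ∈X (4ₕ p (ℕ.n<1+n _ ∷ ≺-mono A (ℕ.n≤1+n _) p)))
              (□-mono _ q (ℕ.≤⇒≤′ m<n))

    -- Induction on `Γ` for all `A`: the head `C` is curried to the right, the induction hypothesis
    -- boxes `C ⟶ A`, and `Kₕ` distributes the box. For empty `Γ` the conjunction is `⊤`, so `A` is
    -- a theorem and necessitation applies.
    normality : ∀ {Ξ n Γ A} .(p : A ≺ n) → All (Boxable Ξ n) Γ →
                ⊢ ⋀ Γ ⟶ A → ⊢ Ξ ⟶ □ n A p
    normality {Ξ} {n} {A = A} p [] d =
      consequence₁ (Ξ ⟶ □ n A p) (λ v t → ⟶⁺ Ξ (□ n A p) (λ _ → t))
        (necessitation p (modusPonens d (valid ⊤ _)))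
    normality {Ξ} {n} {C ∷ Γ} {A} p (boxable q c ∷ cs) d =
      ⟶-ap (⟶-trans (normality (All.++⁺ q p) cs curried)
                    (axiom Kₕ∈X (Kₕ (All.++⁺ q p) q p)))
           c
      where
      curried : ⊢ ⋀ Γ ⟶ (C ⟶ A)
      curried = consequence₁ (⋀ Γ ⟶ (C ⟶ A))
        (λ v t → ⟶⁺ (⋀ Γ) (C ⟶ A) (λ g → ⟶⁺ C A (λ c →
          ⟶⁻ (⋀ (C ∷ Γ)) A t (⋀⁺ {Γ = C ∷ Γ} (c ∷ ⋀⁻ Γ g)))))
        d

    module _ {Ξ : Fm} {n : ℕ} where

      boxable-bodies : (σs : List (Below n)) → All (λ σ → ⊢ Ξ ⟶ box σ) σs →
                       All (Boxable Ξ n) (map body σs)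
      boxable-bodies []              []       = []
      boxable-bodies ((A , p) ∷ σs) (d ∷ ds) =
        boxable p d ∷ boxable-bodies σs ds

      boxable-lower-bodies : (γs : List BoxData) → All (λ γ → proj₁ γ < n) γs →
                             All (λ γ → ⊢ Ξ ⟶ box (proj₂ γ)) γs →
                             All (Boxable Ξ n) (bodies γs)
      boxable-lower-bodies [] [] [] = []
      boxable-lower-bodies ((m , (A , p)) ∷ γs) (m<n ∷ ls) (d ∷ ds) =
        boxable (≺-mono A (ℕ.<⇒≤ m<n) p) (⟶-trans d (□-mono< p _ m<n)) ∷
        boxable-lower-bodies γs ls ds

      -- Here the side condition serves twice: it bounds the outermost index of the boxed formula,
      -- and it permits `□-transitive`.
      boxable-lower-boxes : (γs : List BoxData) → All (λ γ → proj₁ γ < n) γs →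
                            All (λ γ → ⊢ Ξ ⟶ box (proj₂ γ)) γs →
                            All (Boxable Ξ n) (boxes γs)
      boxable-lower-boxes [] [] [] = []
      boxable-lower-boxes ((m , (A , p)) ∷ γs) (m<n ∷ ls) (d ∷ ds) =
        boxable (m<n ∷ ≺-mono A (ℕ.<⇒≤ m<n) p)
                (⟶-trans d (□-transitive p _ m<n)) ∷
        boxable-lower-boxes γs ls ds

    module _ {n : ℕ} (σs : List (Below n)) (γs : List BoxData)
             (ls : All (λ γ → proj₁ γ < n) γs) where

      private
        Ξ : Fm
        Ξ = ⋀ (map box σs ++ boxes γs)

        projections : All (λ C → ⊢ Ξ ⟶ C) (map box σs ++ boxes γs)
        projections = All.tabulate ⋀-project

        σ-boxable : All (Boxable Ξ n) (map body σs)
        σ-boxable =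
          boxable-bodies σs (All.map⁻ (All.++⁻ˡ (map box σs) projections))

        γ-derived : All (λ γ → ⊢ Ξ ⟶ box (proj₂ γ)) γs
        γ-derived = All.map⁻ (All.++⁻ʳ (map box σs) projections)

      -- Every formula in the premise's antecedent is boxable under `Ξ`, the conjunction of the
      -- conclusion's antecedent. With `A` in place of `⋁ [ A ]`, the case `A = ⊥` also serves
      -- `□DR`.
      □4-sound : ∀ {A} .(p : A ≺ n) →
                 ⊢ ⋀ (map body σs ++ bodies γs ++ boxes γs) ⟶ A → ⊢ Ξ ⟶ □ n A p
      □4-sound p = normality p
        (All.++⁺ σ-boxable (All.++⁺ (boxable-lower-bodies γs ls γ-derived)
                                    (boxable-lower-boxes γs ls γ-derived)))

      □S-sound : ∀ {A} .(p : A ≺ n) →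
                 ⊢ ⋀ (map body σs ++ boxes γs) ⟶ A → ⊢ Ξ ⟶ □ n A p
      □S-sound p = normality p
        (All.++⁺ σ-boxable (boxable-lower-boxes γs ls γ-derived))

    -- Needed because `⋁ [ A ]` is `A ∨ ⊥` and not `A` itself.
    singleton⁻ : ∀ {B A} → ⊢ B ⟶ ⋁ [ A ] → ⊢ B ⟶ A
    singleton⁻ {B} {A} = consequence₁ (B ⟶ A) λ v t → ⟶⁺ B A λ b →
      case ⋁⁻ [ A ] (⟶⁻ B (⋁ [ A ]) t b) of λ { (here a) → a }

    singleton⁺ : ∀ {B A} → ⊢ B ⟶ A → ⊢ B ⟶ ⋁ [ A ]
    singleton⁺ {B} {A} = consequence₁ (B ⟶ ⋁ [ A ]) λ v t → ⟶⁺ B (⋁ [ A ]) λ b →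
      ⋁⁺ {Δ = [ A ]} (here (⟶⁻ B A t b))

    □4R-sound : ∀ {S S′} → ModalInference □4R S S′ → ⊢ formula S → ⊢ formula S′
    □4R-sound (□4R n σs γs (A , p) ls) = singleton⁺ ∘ □4-sound σs γs ls p ∘ singleton⁻

    □SR-sound : ∀ {S S′} → ModalInference □SR S S′ → ⊢ formula S → ⊢ formula S′
    □SR-sound (□SR n σs γs (A , p) ls) = singleton⁺ ∘ □S-sound σs γs ls p ∘ singleton⁻

    □DR-sound : Dₕ ∈ X → ∀ {S S′} →
                ModalInference □DR S S′ → ⊢ formula S → ⊢ formula S′
    □DR-sound Dₕ∈X (□DR n σs γs ls) d =
      -- The empty succedent reads as `⊥`, so the premise yields `Ξ ⟶ □ n ⊥`, which `Dₕ` refutes.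
      consequence₂ (Ξ ⟶ ⊥)
        (λ v f g → ⟶⁺ Ξ ⊥ (¬⁻ {v} (□ n ⊥ []) g ∘ ⟶⁻ Ξ (□ n ⊥ []) f))
        (□4-sound σs γs ls [] d) (axiom Dₕ∈X (Dₕ []))
      where
      Ξ : Fm
      Ξ = ⋀ (map box σs ++ boxes γs)

  □L-sound : Tₕ ∈ X → ∀ {S S′} →
             ModalInference □L S S′ → ⊢ formula S → ⊢ formula S′
  □L-sound Tₕ∈X (□L {Γ} {Δ} n (A , p)) d =
    consequence₂ (formula (□ n A p ∷ Γ ⇒ Δ))
      (λ v s t → ⊩⇒⊨ (□ n A p ∷ Γ ⇒ Δ) λ { (b ∷ g) →
        ⊨⇒⊩ (A ∷ Γ ⇒ Δ) s (⟶⁻ (□ n A p) A t b ∷ g) })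
      d (axiom Tₕ∈X (Tₕ p))

  -- Soundness of the calculus, given soundness of its modal rules

  sound : ∀ {Y} →
          (∀ {r S S′} → r ∈ Y → ModalInference r S S′ → ⊢ formula S → ⊢ formula S′) →
          ∀ {S} → SequentCalculus Y S → ⊢ formula S
  sound modal-sound = go
    where
    go : ∀ {S} → SequentCalculus _ S → ⊢ formula S
    go (ax {A}) = sequent₀ ([ A ] ⇒ [ A ]) λ { v (a ∷ []) → here a }
    go ⊥L = sequent₀ ([ ⊥ ] ⇒ []) λ { v (() ∷ []) }
    go ⊤R = sequent₀ ([] ⇒ [ ⊤ ]) λ { v [] → here _ }
    go (exchange {Γ} {Γ′} {Δ} {Δ′} l r d) = sequent₁ (Γ ⇒ Δ) (Γ′ ⇒ Δ′)
      (λ v s → Any-resp-↭ r ∘ s ∘ All-resp-↭ (↭-sym l)) (go d)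
    go (weakeningL {Γ} {Δ} {A} d) = sequent₁ (Γ ⇒ Δ) (A ∷ Γ ⇒ Δ)
      (λ { v s (_ ∷ g) → s g }) (go d)
    go (weakeningR {Γ} {Δ} {A} d) = sequent₁ (Γ ⇒ Δ) (Γ ⇒ A ∷ Δ)
      (λ v s → there ∘ s) (go d)
    go (contractionL {Γ} {Δ} {A} d) = sequent₁ (A ∷ A ∷ Γ ⇒ Δ) (A ∷ Γ ⇒ Δ)
      (λ { v s (a ∷ g) → s (a ∷ a ∷ g) }) (go d)
    go (contractionR {Γ} {Δ} {A} d) = sequent₁ (Γ ⇒ A ∷ A ∷ Δ) (Γ ⇒ A ∷ Δ)
      (λ v s g → case s g of λ { (here a) → here a ; (there t) → t }) (go d)
    go (cut {Γ₀} {Γ₁} {Δ₀} {Δ₁} {A} d e) =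
      sequent₂ (Γ₀ ⇒ A ∷ Δ₀) (A ∷ Γ₁ ⇒ Δ₁) (Γ₀ ++ Γ₁ ⇒ Δ₀ ++ Δ₁)
        (λ v s t g → case s (All.++⁻ˡ Γ₀ g) of λ
          { (here a)  → Any.++⁺ʳ Δ₀ (t (a ∷ All.++⁻ʳ Γ₀ g))
          ; (there x) → Any.++⁺ˡ x })
        (go d) (go e)
    go (∧L₁ {Γ} {Δ} {A} {B} d) = sequent₁ (A ∷ Γ ⇒ Δ) (A ∧ B ∷ Γ ⇒ Δ)
      (λ { v s (a ∷ g) → s (proj₁ (to T-∧ a) ∷ g) }) (go d)
    go (∧L₂ {Γ} {Δ} {A} {B} d) = sequent₁ (B ∷ Γ ⇒ Δ) (A ∧ B ∷ Γ ⇒ Δ)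
      (λ { v s (a ∷ g) → s (proj₂ (to (T-∧ {⟦ A ⟧ v}) a) ∷ g) }) (go d)
    go (∧R {Γ} {Δ} {A} {B} d e) =
      sequent₂ (Γ ⇒ A ∷ Δ) (Γ ⇒ B ∷ Δ) (Γ ⇒ A ∧ B ∷ Δ)
        (λ v s t g → case s g of λ
          { (there x) → there x
          ; (here a)  → case t g of λ
              { (there x) → there x
              ; (here b)  → here (from T-∧ (a , b)) } })
        (go d) (go e)
    go (∨L {Γ} {Δ} {A} {B} d e) =
      sequent₂ (A ∷ Γ ⇒ Δ) (B ∷ Γ ⇒ Δ) (A ∨ B ∷ Γ ⇒ Δ)
        (λ { v s t (a ∷ g) →
          Sum.[ (λ x → s (x ∷ g)) , (λ x → t (x ∷ g)) ] (to (T-∨ {⟦ A ⟧ v}) a) })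
        (go d) (go e)
    go (∨R₁ {Γ} {Δ} {A} {B} d) = sequent₁ (Γ ⇒ A ∷ Δ) (Γ ⇒ A ∨ B ∷ Δ)
      (λ v s g → case s g of λ
        { (here a) → here (from T-∨ (inj₁ a)) ; (there x) → there x })
      (go d)
    go (∨R₂ {Γ} {Δ} {A} {B} d) = sequent₁ (Γ ⇒ B ∷ Δ) (Γ ⇒ A ∨ B ∷ Δ)
      (λ v s g → case s g of λ
        { (here b) → here (from (T-∨ {⟦ A ⟧ v}) (inj₂ b)) ; (there x) → there x })
      (go d)
    go (⟶L {Γ₀} {Γ₁} {Δ₀} {Δ₁} {A} {B} d e) =
      sequent₂ (Γ₀ ⇒ A ∷ Δ₀) (B ∷ Γ₁ ⇒ Δ₁) ((A ⟶ B) ∷ Γ₀ ++ Γ₁ ⇒ Δ₀ ++ Δ₁)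
        (λ { v s t (f ∷ g) → case s (All.++⁻ˡ Γ₀ g) of λ
          { (here a)  → Any.++⁺ʳ Δ₀ (t (⟶⁻ A B f a ∷ All.++⁻ʳ Γ₀ g))
          ; (there x) → Any.++⁺ˡ x } })
        (go d) (go e)
    go (⟶R {Γ} {Δ} {A} {B} d) = sequent₁ (A ∷ Γ ⇒ B ∷ Δ) (Γ ⇒ (A ⟶ B) ∷ Δ)
      (λ v s g → case ⊨-cases A of λ
        { (inj₁ a)  → case s (a ∷ g) of λ
            { (here b) → here (⟶⁺ A B (λ _ → b)) ; (there x) → there x }
        ; (inj₂ ¬a) → here (from (T-∨ {not (⟦ A ⟧ v)}) (inj₁ ¬a)) })
      (go d)
    go (¬L {Γ} {Δ} {A} d) = sequent₁ (Γ ⇒ A ∷ Δ) (¬ A ∷ Γ ⇒ Δ)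
      (λ { v s (¬a ∷ g) → case s g of λ
        { (here a) → case ¬⁻ A ¬a a of λ () ; (there x) → x } })
      (go d)
    go (¬R {Γ} {Δ} {A} d) = sequent₁ (A ∷ Γ ⇒ Δ) (Γ ⇒ ¬ A ∷ Δ)
      (λ v s g → case ⊨-cases A of λ
        { (inj₁ a) → there (s (a ∷ g)) ; (inj₂ ¬a) → here ¬a })
      (go d)
    go (modal r∈Y i d) = modal-sound r∈Y i (go d)

-- Sequent calculi

-- Boxed formulas are not entered, in agreement with `⟦_⟧`. Repetitions are kept.
primes : Fm → List Fm
primes (atom p)  = [ atom p ]
primes ⊥         = []
primes ⊤         = []
primes (¬ A)     = primes A
primes (A ∧ B)   = primes A ++ primes B
primes (A ∨ B)   = primes A ++ primes B
primes (A ⟶ B)   = primes A ++ primes B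
primes (□ n A p) = [ □ n A p ]

valued : Bool → Valuation → List Fm → List Fm
valued b v = filter (λ P → v P Bool.≟ b)

infixl 5 _[_≔_]

_[_≔_] : Valuation → Fm → Bool → Valuation
(v [ P ≔ c ]) Q = if ⌊ Q ≟ P ⌋ then c else v Q

-- The update changes nothing away from `P`, and all copies of `P`, even those repeated in `Ps`, are
-- matched with the head.
valued-≔ : ∀ b v P c Ps → valued b (v [ P ≔ c ]) (P ∷ Ps) ⊆ P ∷ valued b v Ps
valued-≔ b v P c Ps {Q} Q∈
  with Q∈P∷Ps , eq ← ∈-filter⁻ (λ R → (v [ P ≔ c ]) R Bool.≟ b) {xs = P ∷ Ps} Q∈
  with Q ≟ P
... | yes Q≡P = here Q≡P
... | no Q≢P  = there (∈-filter⁺ (λ R → v R Bool.≟ b) (Any.tail Q≢P Q∈P∷Ps) eq)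

-- When `P` receives the other value, no copy of it passes the filter.
valued-≔-≢ : ∀ {b c} → c ≢ b → ∀ v P Ps →
             valued b (v [ P ≔ c ]) (P ∷ Ps) ⊆ valued b v Ps
valued-≔-≢ {b} {c} c≢b v P Ps {Q} Q∈
  with Q∈P∷Ps , eq ← ∈-filter⁻ (λ R → (v [ P ≔ c ]) R Bool.≟ b) {xs = P ∷ Ps} Q∈
  with Q ≟ P
... | yes _  = contradiction eq c≢b
... | no Q≢P = ∈-filter⁺ (λ R → v R Bool.≟ b) (Any.tail Q≢P Q∈P∷Ps) eq

∈⇒↭ : ∀ {A : Fm} {Γ} → A ∈ Γ → ∃ λ Γ′ → Γ ↭ A ∷ Γ′
∈⇒↭ A∈Γ with Γ₁ , Γ₂ , refl ← ∈-∃++ A∈Γ = Γ₁ ++ Γ₂ , shift _ Γ₁ Γ₂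

-- Derived structural rules

module Calculus {Y : List ModalRule} where

  infix 3 ⊢_

  ⊢_ : Sequent → Set
  ⊢ S = SequentCalculus Y S

  absorbL : ∀ {A Γ Δ} → A ∈ Γ → ⊢ A ∷ Γ ⇒ Δ → ⊢ Γ ⇒ Δ
  absorbL A∈Γ d with _ , p ← ∈⇒↭ A∈Γ =
    exchange (↭-sym p) ↭-refl (contractionL (exchange (prep _ p) ↭-refl d))

  absorbR : ∀ {A Γ Δ} → A ∈ Δ → ⊢ Γ ⇒ A ∷ Δ → ⊢ Γ ⇒ Δ
  absorbR A∈Δ d with _ , p ← ∈⇒↭ A∈Δ =
    exchange ↭-refl (↭-sym p) (contractionR (exchange ↭-refl (prep _ p) d))

  absorbL* : ∀ {Γ Γ′ Δ} → Γ ⊆ Γ′ → ⊢ Γ ++ Γ′ ⇒ Δ → ⊢ Γ′ ⇒ Δ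
  absorbL* {[]}    _    d = d
  absorbL* {_ ∷ Γ} Γ⊆Γ′ d =
    absorbL* (Γ⊆Γ′ ∘ there) (absorbL (∈-++⁺ʳ Γ (Γ⊆Γ′ (here refl))) d)

  absorbR* : ∀ {Γ Δ Δ′} → Δ ⊆ Δ′ → ⊢ Γ ⇒ Δ ++ Δ′ → ⊢ Γ ⇒ Δ′
  absorbR* {Δ = []}    _    d = d
  absorbR* {Δ = _ ∷ Δ} Δ⊆Δ′ d =
    absorbR* (Δ⊆Δ′ ∘ there) (absorbR (∈-++⁺ʳ Δ (Δ⊆Δ′ (here refl))) d)

  weakenL* : ∀ Γ′ {Γ Δ} → ⊢ Γ ⇒ Δ → ⊢ Γ′ ++ Γ ⇒ Δ
  weakenL* []       d = d
  weakenL* (_ ∷ Γ′) d = weakeningL (weakenL* Γ′ d)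

  weakenR* : ∀ Δ′ {Γ Δ} → ⊢ Γ ⇒ Δ → ⊢ Γ ⇒ Δ′ ++ Δ
  weakenR* []       d = d
  weakenR* (_ ∷ Δ′) d = weakeningR (weakenR* Δ′ d)

  -- Weakening adds `Γ′` and `Δ′` in full; each original formula then has a second copy there and is
  -- contracted into it. Contexts may thus be treated as sets.
  structural : ∀ {Γ Γ′ Δ Δ′} → Γ ⊆ Γ′ → Δ ⊆ Δ′ → ⊢ Γ ⇒ Δ → ⊢ Γ′ ⇒ Δ′
  structural {Γ} {Γ′} {Δ} {Δ′} Γ⊆Γ′ Δ⊆Δ′ d = absorbL* Γ⊆Γ′ (absorbR* Δ⊆Δ′
    (exchange (++-comm Γ′ Γ) (++-comm Δ′ Δ) (weakenL* Γ′ (weakenR* Δ′ d))))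

  ax-∈ : ∀ {A Γ Δ} → A ∈ Γ → A ∈ Δ → ⊢ Γ ⇒ Δ
  ax-∈ A∈Γ A∈Δ = structural (∈-∷⁺ʳ A∈Γ λ ()) (∈-∷⁺ʳ A∈Δ λ ()) ax

  cut-shared : ∀ {A Γ Δ} → ⊢ Γ ⇒ A ∷ Δ → ⊢ A ∷ Γ ⇒ Δ → ⊢ Γ ⇒ Δ
  cut-shared {Γ = Γ} {Δ} d e =
    structural (Sum.[ id , id ] ∘ ∈-++⁻ Γ) (Sum.[ id , id ] ∘ ∈-++⁻ Δ) (cut d e)

  ⟶L-shared : ∀ {A B Γ Δ} → ⊢ Γ ⇒ A ∷ Δ → ⊢ B ∷ Γ ⇒ Δ → ⊢ (A ⟶ B) ∷ Γ ⇒ Δ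
  ⟶L-shared {Γ = Γ} {Δ} d e =
    structural (∷⁺ʳ _ (Sum.[ id , id ] ∘ ∈-++⁻ Γ)) (Sum.[ id , id ] ∘ ∈-++⁻ Δ)
      (⟶L d e)

  -- Kalmár's argument for tautologies

  module Kalmár (Γ Δ : List Fm) where

    -- Indexing by the truth value lets the lemmas for the connectives follow the clauses of `⟦_⟧`
    -- definitionally.
    Decided : Bool → Fm → Set
    Decided true  A = ⊢ Γ ⇒ A ∷ Δ
    Decided false A = ⊢ A ∷ Γ ⇒ Δ

    decided-¬ : ∀ a {A} → Decided a A → Decided (not a) (¬ A)
    decided-¬ true  = ¬L
    decided-¬ false = ¬R

    decided-∧ : ∀ a b {A B} → Decided a A → Decided b B →
                Decided (a Bool.∧ b) (A ∧ B)
    decided-∧ true  true  d e = ∧R d e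
    decided-∧ true  false d e = ∧L₂ e
    decided-∧ false b     d e = ∧L₁ d

    decided-∨ : ∀ a b {A B} → Decided a A → Decided b B →
                Decided (a Bool.∨ b) (A ∨ B)
    decided-∨ true  b     d e = ∨R₁ d
    decided-∨ false true  d e = ∨R₂ e
    decided-∨ false false d e = ∨L d e

    decided-⟶ : ∀ a b {A B} → Decided a A → Decided b B →
                Decided (not a Bool.∨ b) (A ⟶ B)
    decided-⟶ true  true  d e = ⟶R (weakeningL e)
    decided-⟶ true  false d e = ⟶L-shared d e
    decided-⟶ false b     d e = ⟶R (structural ⊆-refl there d)

    decided : ∀ v A → All (λ P → Decided (v P) P) (primes A) → Decided (⟦ A ⟧ v) A
    decided v (atom p)  (d ∷ []) = d
    decided v ⊥         _  = structural (∷⁺ʳ _ λ ()) (λ ()) ⊥L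
    decided v ⊤         _  = structural (λ ()) (∷⁺ʳ _ λ ()) ⊤R
    decided v (¬ A)     ds = decided-¬ (⟦ A ⟧ v) (decided v A ds)
    decided v (A ∧ B)   ds = decided-∧ (⟦ A ⟧ v) (⟦ B ⟧ v)
      (decided v A (All.++⁻ˡ _ ds)) (decided v B (All.++⁻ʳ (primes A) ds))
    decided v (A ∨ B)   ds = decided-∨ (⟦ A ⟧ v) (⟦ B ⟧ v)
      (decided v A (All.++⁻ˡ _ ds)) (decided v B (All.++⁻ʳ (primes A) ds))
    decided v (A ⟶ B)   ds = decided-⟶ (⟦ A ⟧ v) (⟦ B ⟧ v)
      (decided v A (All.++⁻ˡ _ ds)) (decided v B (All.++⁻ʳ (primes A) ds))
    decided v (□ n A p) (d ∷ []) = d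

  open Kalmár

  -- Each prime of `A` lies on the side given by its value, so an axiom decides it. Hence `A` is
  -- decided with value `⟦ A ⟧ v`, which `taut v` turns into `true`.
  tautology-relative : ∀ {A} → Tautology A → ∀ v →
    ⊢ valued true v (primes A) ⇒ A ∷ valued false v (primes A)
  tautology-relative {A} taut v =
    subst (λ b → Decided Γ Δ b A) (taut v) (decided Γ Δ v A (All.tabulate literal))
    where
    Γ Δ : List Fm
    Γ = valued true  v (primes A)
    Δ = valued false v (primes A)

    literal : ∀ {P} → P ∈ primes A → Decided Γ Δ (v P) P
    literal {P} P∈ with v P in eq
    ... | true  = ax-∈ (∈-filter⁺ (λ Q → v Q Bool.≟ true) P∈ eq) (here refl)
    ... | false = ax-∈ (here refl) (∈-filter⁺ (λ Q → v Q Bool.≟ false) P∈ eq)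

  -- The hypothesis is used at both updates of `v` on `P`: the value `false` puts `P` on the right,
  -- `true` on the left, and a cut removes it.
  cut-primes : ∀ {A} Ps → (∀ v → ⊢ valued true v Ps ⇒ A ∷ valued false v Ps) →
               ⊢ [] ⇒ [ A ]
  -- With no primes left the sequent no longer depends on the valuation, so any one will do.
  cut-primes     []       h = h (λ _ → true)
  cut-primes {A} (P ∷ Ps) h = cut-primes Ps λ v → cut-shared
    (structural (valued-≔-≢ (λ ()) v P Ps)
                -- `P` has to move in front of `A` to become the cut formula.
                (∈-∷⁺ʳ (there (here refl)) (∷⁺ʳ P there ∘ valued-≔ false v P false Ps))
                (h (v [ P ≔ false ])))
    (structural (valued-≔ true v P true Ps)
                (∷⁺ʳ A (valued-≔-≢ (λ ()) v P Ps))
                (h (v [ P ≔ true ])))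

  tautology-derivable : ∀ {A} → Tautology A → ⊢ [] ⇒ [ A ]
  tautology-derivable {A} taut = cut-primes (primes A) (tautology-relative taut)

  -- Completeness: deriving Hilbert proofs in the calculus

  detach : ∀ {A B} → ⊢ [] ⇒ [ A ⟶ B ] → ⊢ [ A ] ⇒ [ B ]
  detach d = cut d (⟶L ax ax)

  modusPonens-derivable : ∀ {A B} → ⊢ [] ⇒ [ A ⟶ B ] → ⊢ [] ⇒ [ A ] → ⊢ [] ⇒ [ B ]
  modusPonens-derivable d e = cut e (detach d)

  ⋀R : ∀ Γ → ⊢ Γ ⇒ [ ⋀ Γ ]
  ⋀R []      = ⊤R
  ⋀R (A ∷ Γ) = ∧R (ax-∈ (here refl) (here refl)) (weakeningL (⋀R Γ))

  ⋁L : ∀ Δ → ⊢ [ ⋁ Δ ] ⇒ Δ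
  ⋁L []      = ⊥L
  ⋁L (A ∷ Δ) = ∨L (ax-∈ (here refl) (here refl)) (weakeningR (⋁L Δ))

  -- After detaching, `⋀ Γ` and `⋁ Δ` are cut away against `⋀R` and `⋁L`.
  unfold : ∀ Γ Δ → ⊢ [] ⇒ [ formula (Γ ⇒ Δ) ] → ⊢ Γ ⇒ Δ
  unfold Γ Δ d = exchange (↭-reflexive (++-identityʳ Γ)) ↭-refl
    (cut (⋀R Γ) (cut (detach d) (⋁L Δ)))

  module _ (□-necessitation : ∀ {n A} .(p : A ≺ n) → ⊢ [] ⇒ [ A ] → ⊢ [] ⇒ [ □ n A p ])
           {X : List Scheme}
           (axiom-derivable : ∀ {s A} → s ∈ X → Instance s A → ⊢ [] ⇒ [ A ]) where

    complete : ∀ {A} → HilbertSystem X A → ⊢ [] ⇒ [ A ]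
    complete (tautology t)       = tautology-derivable t
    complete (axiom s∈X i)       = axiom-derivable s∈X i
    complete (modusPonens d e)   = modusPonens-derivable (complete d) (complete e)
    complete (necessitation p d) = □-necessitation p (complete d)

  module □4 (r : □4R ∈ Y) where

    □-necessitation : ∀ {n A} .(p : A ≺ n) → ⊢ [] ⇒ [ A ] → ⊢ [] ⇒ [ □ n A p ]
    □-necessitation {n} {A} p = modal r (□4R n [] [] (A , p) [])

    -- `□ n A` enters the rule as one of the `γs`, since `n < suc n`. The premise then contains both
    -- `A` and `□ n A`, which makes it an axiom up to weakening here and for `4ₕ`.
    H-derivable : ∀ {A} → Instance H A → ⊢ [] ⇒ [ A ]
    H-derivable (H {n} {A} p q) = ⟶R (modal r
      (□4R (suc n) [] [ n , (A , p) ] (A , q) (ℕ.n<1+n n ∷ []))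
      (ax-∈ (here refl) (here refl)))

    Kₕ-derivable : ∀ {A} → Instance Kₕ A → ⊢ [] ⇒ [ A ]
    Kₕ-derivable (Kₕ {n} {A} {B} p q r′) =
      -- Both boxes have index `n` and enter as `σs`, leaving `A ⟶ B , A ⇒ B`. The swap is due to
      -- `⟶R`, which discharges the front formula first.
      ⟶R (⟶R (exchange (↭-swap _ _ ↭-refl) ↭-refl (modal r
        (□4R n ((A ⟶ B , p) ∷ (A , q) ∷ []) [] (B , r′) [])
        (⟶L ax ax))))

    4ₕ-derivable : ∀ {A} → Instance 4ₕ A → ⊢ [] ⇒ [ A ]
    4ₕ-derivable (4ₕ {n} {A} p q) = ⟶R (modal r
      (□4R (suc n) [] [ n , (A , p) ] (□ n A p , q) (ℕ.n<1+n n ∷ []))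
      (ax-∈ (there (here refl)) (here refl)))

  Dₕ-derivable : □DR ∈ Y → ∀ {A} → Instance Dₕ A → ⊢ [] ⇒ [ A ]
  Dₕ-derivable r (Dₕ {n} p) = ¬R (modal r (□DR n [ ⊥ , p ] [] []) ⊥L)

  Tₕ-derivable : □L ∈ Y → ∀ {A} → Instance Tₕ A → ⊢ [] ⇒ [ A ]
  Tₕ-derivable r (Tₕ {n} {A} p) = ⟶R (modal r (□L n (A , p)) ax)

  module □S (r : □SR ∈ Y) where

    □-necessitation : ∀ {n A} .(p : A ≺ n) → ⊢ [] ⇒ [ A ] → ⊢ [] ⇒ [ □ n A p ]
    □-necessitation {n} {A} p = modal r (□SR n [] [] (A , p) [])

    -- The premise of `□SR` keeps `□ n A` but not its body, so `□L` has to recover `A`.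
    H-derivable : □L ∈ Y → ∀ {A} → Instance H A → ⊢ [] ⇒ [ A ]
    H-derivable l (H {n} {A} p q) = ⟶R (modal r
      (□SR (suc n) [] [ n , (A , p) ] (A , q) (ℕ.n<1+n n ∷ []))
      (modal l (□L n (A , p)) ax))

    Kₕ-derivable : ∀ {A} → Instance Kₕ A → ⊢ [] ⇒ [ A ]
    Kₕ-derivable (Kₕ {n} {A} {B} p q r′) =
      ⟶R (⟶R (exchange (↭-swap _ _ ↭-refl) ↭-refl (modal r
        (□SR n ((A ⟶ B , p) ∷ (A , q) ∷ []) [] (B , r′) [])
        (⟶L ax ax))))

    4ₕ-derivable : ∀ {A} → Instance 4ₕ A → ⊢ [] ⇒ [ A ]
    4ₕ-derivable (4ₕ {n} {A} p q) = ⟶R (modal r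
      (□SR (suc n) [] [ n , (A , p) ] (□ n A p , q) (ℕ.n<1+n n ∷ []))
      ax)

-- The three logics

G⇒L : ∀ L {S} → G L ⊢ S → L ⊢ formula S
G⇒L K4ₕ = sound λ { (here refl) → □4R-sound }
  where
  open Hilbert
  open Normal (here refl) (there (here refl)) (there (there (here refl)))
G⇒L KD4ₕ = sound λ
  { (here refl)         → □4R-sound
  ; (there (here refl)) → □DR-sound (there (there (there (here refl)))) }
  where
  open Hilbert
  open Normal (here refl) (there (here refl)) (there (there (here refl)))
G⇒L S4ₕ = sound λ
  { (here refl)         → □SR-sound
  ; (there (here refl)) → □L-sound (there (there (there (here refl)))) }
  where
  open Hilbert
  open Normal (here refl) (there (here refl)) (there (there (here refl)))

L⇒G : ∀ L {A} → L ⊢ A → G L ⊢ [] ⇒ [ A ]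
L⇒G K4ₕ = complete □-necessitation λ
  { (here refl)                 → H-derivable
  ; (there (here refl))         → Kₕ-derivable
  ; (there (there (here refl))) → 4ₕ-derivable }
  where
  open Calculus
  open □4 (here refl)
L⇒G KD4ₕ = complete □-necessitation λ
  { (here refl)                         → H-derivable
  ; (there (here refl))                 → Kₕ-derivable
  ; (there (there (here refl)))         → 4ₕ-derivable
  ; (there (there (there (here refl)))) → Dₕ-derivable (there (here refl)) }
  where
  open Calculus
  open □4 (here refl)
L⇒G S4ₕ = complete □-necessitation λ
  { (here refl)                         → H-derivable (there (here refl))
  ; (there (here refl))                 → Kₕ-derivable
  ; (there (there (here refl)))         → 4ₕ-derivable
  ; (there (there (there (here refl)))) → Tₕ-derivable (there (here refl)) }
  where
  open Calculus
  open □S (here refl)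

-- Soundness for `⇒ A` yields `⊤ ⟶ A ∨ ⊥`, of which `A` is a tautological consequence.
⊢⋁[A]⇒⊢A : ∀ L {A} → L ⊢ formula ([] ⇒ [ A ]) → L ⊢ A
⊢⋁[A]⇒⊢A L {A} = Hilbert.consequence₁ A λ v t →
  case ⊨⇒⊩ ([] ⇒ [ A ]) t [] of λ { (here a) → a }

theorem3p7 : (L : Logic) →
    ((Γ Δ : List Fm) → (G L ⊢ Γ ⇒ Δ) ⇔ (L ⊢ ⋀ Γ ⟶ ⋁ Δ)) ×
    ((A : Fm) → (L ⊢ A) ⇔ (G L ⊢ [] ⇒ [ A ]))
theorem3p7 L =
  (λ Γ Δ → mk⇔ (G⇒L L) (Calculus.unfold Γ Δ ∘ L⇒G L)) ,
  (λ A → mk⇔ (L⇒G L) (⊢⋁[A]⇒⊢A L ∘ G⇒L L))
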